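{- Let $d\ge 1$ be an integer. For every $N\in\mathbb{Z}_{\ge 0}$, $$g_d(N)=\sum_{j=0}^{d-1}\binom{N+2d-2-j}{2d-2}=\binom{N+2d-1}{2d-1}-\binom{N+d-1}{2d-1}.$$
   Context: Let $[d]=\{1,\dots,d\}$. A matrix $A\in\mathbb{R}^{d\times d}$ is a $G$-matrix of value $N\in\mathbb{R}_{\ge 0}$ if all its entries are nonnegative and $A_{1,\sigma(1)}+A_{2,\sigma(2)}+\cdots+A_{d,\sigma(d)}=N$ for every permutation $\sigma$ of $[d]$. For $N\in\mathbb{Z}_{\ge 0}$, $g_d(N)$ denotes the number of $d\times d$ $G$-matrices of value $N$ all of whose entries are integers. As usual $\binom{n}{k}=0$ for integers $0\le n<k$. -}

module Defs where

open import Data.Nat.Base using (ℕ)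
import Data.Nat.Properties as ℕ
open import Data.Integer.Base using (ℤ; +_; _≤_)
import Data.Integer.Properties as ℤ
open import Data.Fin.Base using (Fin)
open import Data.Fin.Permutation using (Permutation′; _⟨$⟩ʳ_; ↔⇒≡)
open import Data.Product.Base using (proj₁)
open import Data.Vec.Functional using (Vector)
open import Function.Bundles using (Inverse)
open import Function.Construct.Composition using (inverse)
import Function.Construct.Symmetry as Symmetry
open import Level using (Level; 0ℓ; _⊔_)
open import Relation.Binary.Bundles using (Setoid)
import Relation.Binary.Construct.On as On
open import Relation.Binary.PropositionalEquality using (_≡_; setoid)
import Data.Vec.Functional.Relation.Binary.Equality.Setoid as Pointwise
import Algebra.Properties.CommutativeMonoid.Sum ℤ.+-0-commutativeMonoid as ℤSum

open import Algebra.Properties.CommutativeMonoid.Sum ℕ.+-0-commutativeMonoid public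
  using (sum-syntax)

private
  variable
    a ℓ : Level

Matrix : ℕ → Set
Matrix d = Vector (Vector ℤ d) d

-- Only integer matrices are counted, and for these the condition over ℝ
-- and the condition over ℤ coincide, so the definition is given over ℤ.
record IsGMatrix {d : ℕ} (N : ℕ) (A : Matrix d) : Set where
  field
    nonNegative : ∀ i j → + 0 ≤ A i j
    value       : ∀ (σ : Permutation′ d) → ℤSum.sum (λ i → A i (σ ⟨$⟩ʳ i)) ≡ + N

-- Two elements are equal when all their entries agree; the proofs of
-- IsGMatrix are not compared, so each matrix is counted once.
GMatrices : ℕ → ℕ → Setoid 0ℓ 0ℓ
GMatrices d N = On.setoid (Pointwise.≋-setoid (Pointwise.≋-setoid (setoid ℤ) d) d)
                         (proj₁ {B = IsGMatrix {d} N})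

HasCardinality : Setoid a ℓ → ℕ → Set (a ⊔ ℓ)
HasCardinality S k = Inverse S (setoid (Fin k))

cardinality-unique : ∀ (S : Setoid a ℓ) {m n : ℕ} →
                     HasCardinality S m → HasCardinality S n → m ≡ n
cardinality-unique S p q = ↔⇒≡ (inverse (Symmetry.inverse p) q)

{-# OPTIONS --safe #-}

-- A G-matrix has the form A i j = x i + y j, and such a pair of vectors
-- (x , y) is unique once min x = 0 is imposed; nonnegativity of A then
-- says that x and y are vectors of naturals, and the value of A is
-- ∑ x + ∑ y.  Suppose that the first zero of x is at position j.  Lowering
-- the j earlier entries by one leaves 2d ∸ 1 unconstrained naturals of sum
-- N ∸ j, which gives the j-th summand; the sum telescopes by Pascal's rule.

module Submission where

open import Defs
open import Data.Nat.Base as ℕ using (ℕ; zero; suc; _+_; _*_; _∸_; _≤_; z≤n; s≤s)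
open import Data.Nat.Combinatorics
  using (_C_; nCn≡1; nCk≡nC[n∸k]; k>n⇒nCk≡0; nCk+nC[k+1]≡[n+1]C[k+1])
import Data.Nat.Properties as ℕ
open import Data.Nat.Tactic.RingSolver using (solve-∀)
open import Data.Integer.Base as ℤ using (+_; _-_; ∣_∣; +≤+; _⊖_)
import Data.Integer.Properties as ℤ
open import Data.Empty using (⊥)
open import Data.Unit.Base using (⊤; tt)
open import Data.Fin.Base using (Fin; zero; suc; toℕ; _↑ˡ_; _↑ʳ_; punchIn)
import Data.Fin.Properties as Fin
open import Data.Fin.Permutation
  using (Permutation; Permutation′; _⟨$⟩ʳ_; id; insert; lift₀; insert-punchIn)
open import Data.Product.Base using (_×_; _,_; Σ-syntax; ∃; ∃-syntax; proj₁; proj₂)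
open import Data.Sum.Base using (_⊎_; inj₁; inj₂)
open import Data.Sum.Function.Propositional using (_⊎-↔_)
open import Data.Vec.Functional using (Vector; _∷_; _++_; head; tail)
open import Data.Vec.Functional.Properties using (lookup-++ˡ; lookup-++ʳ)
open import Function.Base using (_∘_)
open import Function.Bundles using (Inverse; _↔_; mk↔ₛ′)
open import Function.Construct.Composition using (inverse)
open import Function.Properties.Inverse using (↔-sym; ↔-trans)
open import Level using (Level)
open import Relation.Binary.Bundles using (Setoid)
open import Relation.Binary.PropositionalEquality
  using (_≡_; _≗_; refl; sym; trans; cong; cong₂; subst; setoid; module ≡-Reasoning)
open import Relation.Nullary using (yes; no; contradiction)

import Algebra.Properties.CommutativeMonoid.Sum ℤ.+-0-commutativeMonoid as ℤSum
open import Algebra.Properties.CommutativeMonoid.Sum ℕ.+-0-commutativeMonoid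
  using (sum; sum-cong-≗; sum-remove; sum-permute; ∑-distrib-+)

open ≡-Reasoning

private
  variable
    a b ℓ : Level
    k m n N : ℕ

-- Sums of vectors

∑-pos : (f : Vector ℕ n) → ℤSum.sum (λ i → + f i) ≡ + sum f
∑-pos {zero}  f = refl
∑-pos {suc n} f = trans (cong (ℤ._+_ (+ f zero)) (∑-pos (tail f)))
                        (sym (ℤ.pos-+ (f zero) (sum (tail f))))

∑-split : ∀ n (v : Vector ℕ (n + m)) → sum v ≡ sum (v ∘ (_↑ˡ m)) + sum (v ∘ (n ↑ʳ_))
∑-split zero    v = refl
∑-split (suc n) v = trans (cong (v zero ℕ.+_) (∑-split n (tail v))) (sym (ℕ.+-assoc (v zero) _ _))

∑-++ : (x : Vector ℕ n) (y : Vector ℕ m) → sum (x ++ y) ≡ sum x + sum y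
∑-++ {n} x y = trans (∑-split n (x ++ y))
  (cong₂ _+_ (sum-cong-≗ (lookup-++ˡ x y)) (sum-cong-≗ (lookup-++ʳ x y)))

≗-split : ∀ n {v w : Vector ℕ (n + m)} →
          v ∘ (_↑ˡ m) ≗ w ∘ (_↑ˡ m) → v ∘ (n ↑ʳ_) ≗ w ∘ (n ↑ʳ_) → v ≗ w
≗-split zero    l r i       = r i
≗-split (suc n) l r zero    = l zero
≗-split (suc n) l r (suc i) = ≗-split n (l ∘ suc) r i

-- Weak compositions

-- The elements code the `k`-tuples of naturals of sum `N` in the shape of Pascal's rule: `inj₁`
-- stands for a zero first part, `inj₂` for a positive one lowered by one. Codes are compared by
-- propositional equality, whereas vectors agree only pointwise.
WeakComposition : ℕ → ℕ → Set
WeakComposition zero    zero    = ⊤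
WeakComposition zero    (suc N) = ⊥
WeakComposition (suc k) zero    = WeakComposition k zero
WeakComposition (suc k) (suc N) = WeakComposition k (suc N) ⊎ WeakComposition (suc k) N

incrementHead : Vector ℕ (suc k) → Vector ℕ (suc k)
incrementHead v = suc (head v) ∷ tail v

parts : ∀ k N → WeakComposition k N → Vector ℕ k
parts zero    N       w        ()
parts (suc k) zero    w        = 0 ∷ parts k zero w
parts (suc k) (suc N) (inj₁ w) = 0 ∷ parts k (suc N) w
parts (suc k) (suc N) (inj₂ w) = incrementHead (parts (suc k) N w)

∑-parts : ∀ k N (w : WeakComposition k N) → sum (parts k N w) ≡ N
∑-parts zero    zero    w        = refl
∑-parts (suc k) zero    w        = ∑-parts k zero w
∑-parts (suc k) (suc N) (inj₁ w) = ∑-parts k (suc N) w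
∑-parts (suc k) (suc N) (inj₂ w) = cong suc (∑-parts (suc k) N w)

incrementHead-injective : {v w : Vector ℕ (suc k)} → incrementHead v ≗ incrementHead w → v ≗ w
incrementHead-injective eq zero    = ℕ.suc-injective (eq zero)
incrementHead-injective eq (suc i) = eq (suc i)

parts-injective : ∀ k N {w w′ : WeakComposition k N} → parts k N w ≗ parts k N w′ → w ≡ w′
parts-injective zero    zero    eq = refl
parts-injective (suc k) zero    eq = parts-injective k zero (eq ∘ suc)
parts-injective (suc k) (suc N) {inj₁ w} {inj₁ w′} eq =
  cong inj₁ (parts-injective k (suc N) (eq ∘ suc))
parts-injective (suc k) (suc N) {inj₁ w} {inj₂ w′} eq = contradiction (eq zero) λ ()
parts-injective (suc k) (suc N) {inj₂ w} {inj₁ w′} eq = contradiction (eq zero) λ ()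
parts-injective (suc k) (suc N) {inj₂ w} {inj₂ w′} eq =
  cong inj₂ (parts-injective (suc k) N (incrementHead-injective eq))

parts-surjective : ∀ k N (v : Vector ℕ k) → sum v ≡ N → ∃[ w ] parts k N w ≗ v
parts-surjective zero    zero v p = tt , λ ()
parts-surjective (suc k) N    v p = byHead N (head v) (tail v) p _ refl λ _ → refl
  where
  -- Head and tail are separate arguments so that lowering `h` is structural; `v` is tied to them
  -- only by equations.
  byHead : ∀ N h (t : Vector ℕ k) → h + sum t ≡ N →
           (v : Vector ℕ (suc k)) → h ≡ head v → t ≗ tail v → ∃[ w ] parts (suc k) N w ≗ v
  byHead zero zero t p v hd tl with w , eq ← parts-surjective k zero t p =
    w , λ { zero → hd ; (suc i) → trans (eq i) (tl i) }
  byHead (suc N) zero t p v hd tl with w , eq ← parts-surjective k (suc N) t p =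
    inj₁ w , λ { zero → hd ; (suc i) → trans (eq i) (tl i) }
  byHead (suc N) (suc h) t p v hd tl
    with w , eq ← byHead N h t (ℕ.suc-injective p) (h ∷ t) refl (λ _ → refl) =
    inj₂ w , λ { zero → trans (cong suc (eq zero)) hd ; (suc i) → trans (eq (suc i)) (tl i) }

nC0≡1 : ∀ n → n C 0 ≡ 1
nC0≡1 n = trans (nCk≡nC[n∸k] {0} {n} z≤n) (nCn≡1 n)

Fin-cong : m ≡ n → {A : Set a} → A ↔ Fin m → A ↔ Fin n
Fin-cong eq {A} = subst (λ c → A ↔ Fin c) eq

↔-+ : {A : Set a} {B : Set b} → A ↔ Fin m → B ↔ Fin n → (A ⊎ B) ↔ Fin (m + n)
↔-+ f g = ↔-trans (f ⊎-↔ g) (↔-sym Fin.+↔⊎)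

-- Stars and bars: the two summands of the type match the two terms of Pascal's rule.
weakComposition↔Fin : ∀ k N → WeakComposition (suc k) N ↔ Fin ((N + k) C k)
weakComposition↔Fin zero zero = ↔-sym Fin.1↔⊤
weakComposition↔Fin zero (suc N) =
  Fin-cong (trans (nC0≡1 (N + 0)) (sym (nC0≡1 (suc N + 0))))
    (↔-+ (↔-sym Fin.0↔⊥) (weakComposition↔Fin zero N))
weakComposition↔Fin (suc k) zero =
  Fin-cong (trans (nCn≡1 k) (sym (nCn≡1 (suc k)))) (weakComposition↔Fin k zero)
weakComposition↔Fin (suc k) (suc N) =
  Fin-cong pascal (↔-+ (weakComposition↔Fin k (suc N)) (weakComposition↔Fin (suc k) N))
  where
  pascal : (suc N + k) C k + (N + suc k) C suc k ≡ (suc N + suc k) C suc k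
  pascal rewrite ℕ.+-suc N k = nCk+nC[k+1]≡[n+1]C[k+1] (suc (N + k)) k

-- Pairs of vectors whose left component has a zero

-- `here` puts the first zero of the left vector at its head; `there` makes
-- the head of the left vector positive and stores its predecessor as the
-- head of the right vector of the argument.
data ZeroedPair : ℕ → ℕ → ℕ → Set where
  here  : WeakComposition (n + m) N → ZeroedPair (suc n) m N
  there : ZeroedPair n (suc m) N → ZeroedPair (suc n) m (suc N)

right : ZeroedPair n m N → Vector ℕ m
right (here {n} {m} {N} w) = parts (n + m) N w ∘ (n ↑ʳ_)
right (there z)            = tail (right z)

left : ZeroedPair n m N → Vector ℕ n
left (here {n} {m} {N} w) = 0 ∷ (parts (n + m) N w ∘ (_↑ˡ m))
left (there z)            = suc (head (right z)) ∷ left z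

left-zero : (z : ZeroedPair n m N) → ∃[ i ] left z i ≡ 0
left-zero (here w)  = zero , refl
left-zero (there z) with i , eq ← left-zero z = suc i , eq

∑-left-right : (z : ZeroedPair n m N) → sum (left z) + sum (right z) ≡ N
∑-left-right (here {n} {m} {N} w) =
  trans (sym (∑-split n (parts (n + m) N w))) (∑-parts (n + m) N w)
∑-left-right (there z) =
  trans (rotate (head (right z)) (sum (left z)) _) (cong suc (∑-left-right z))
  where
  rotate : ∀ h l r → suc h + l + r ≡ suc (l + (h + r))
  rotate = solve-∀

-- The head of the left vector is zero exactly for `here`, so it determines the constructor.
left-right-injective : {z z′ : ZeroedPair n m N} →
                       left z ≗ left z′ → right z ≗ right z′ → z ≡ z′
left-right-injective {z = here {n} {m} {N} w} {here w′} l r =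
  cong here (parts-injective (n + m) N (≗-split n (l ∘ suc) r))
left-right-injective {z = here w}  {there z′} l r = contradiction (l zero) λ ()
left-right-injective {z = there z} {here w′}  l r = contradiction (l zero) λ ()
left-right-injective {z = there z} {there z′} l r =
  cong there (left-right-injective (l ∘ suc)
    λ { zero → ℕ.suc-injective (l zero) ; (suc i) → r i })

left-right-surjective : ∀ n {m} N (x : Vector ℕ n) (y : Vector ℕ m) (i : Fin n) → x i ≡ 0 →
                        sum x + sum y ≡ N →
                        ∃[ z ] left {n} {m} {N} z ≗ x × right z ≗ y
left-right-surjective (suc n) {m} N x y i xᵢ≡0 p = byHead N (head x) refl p
  where
  byHead : ∀ N h → head x ≡ h → h + sum (tail x) + sum y ≡ N →
           ∃[ z ] left {suc n} {m} {N} z ≗ x × right z ≗ y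
  byHead N zero hd p
    with w , eq ← parts-surjective (n + m) N (tail x ++ y) (trans (∑-++ (tail x) y) p) =
    here w
    , (λ { zero → sym hd ; (suc j) → trans (eq (j ↑ˡ m)) (lookup-++ˡ (tail x) y j) })
    , (λ j → trans (eq (n ↑ʳ j)) (lookup-++ʳ (tail x) y j))
  byHead (suc N) (suc h) hd p = descend i xᵢ≡0
    where
    rotate : ∀ h l r → l + (h + r) ≡ h + l + r
    rotate = solve-∀

    -- The head of `x` is positive here, so the given zero lies in the tail. The predecessor `h`
    -- moves to the front of `y`, and the total drops by one.
    descend : ∀ i → x i ≡ 0 → ∃[ z ] left {suc n} {m} {suc N} z ≗ x × right z ≗ y
    descend zero    x₀≡0 = contradiction (trans (sym hd) x₀≡0) λ ()
    descend (suc i) xᵢ≡0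
      with z , l , r ← left-right-surjective n N (tail x) (h ∷ y) i xᵢ≡0
             (trans (rotate h (sum (tail x)) (sum y)) (ℕ.suc-injective p)) =
      there z
      , (λ { zero → trans (cong suc (r zero)) (sym hd) ; (suc j) → l j })
      , (λ j → r (suc j))

zeroedPair-zero : ZeroedPair (suc n) m zero ↔ WeakComposition (n + m) zero
zeroedPair-zero = mk↔ₛ′ (λ { (here w) → w }) here (λ _ → refl) (λ { (here w) → refl })

zeroedPair-suc : ZeroedPair (suc n) m (suc N) ↔
                 (WeakComposition (n + m) (suc N) ⊎ ZeroedPair n (suc m) N)
zeroedPair-suc = mk↔ₛ′
  (λ { (here w) → inj₁ w ; (there z) → inj₂ z })
  (λ { (inj₁ w) → here w ; (inj₂ z) → there z })
  (λ { (inj₁ w) → refl ; (inj₂ z) → refl })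
  (λ { (here w) → refl ; (there z) → refl })

∑-zero : ∀ n {f : Vector ℕ n} → (∀ i → f i ≡ 0) → sum f ≡ 0
∑-zero zero    f≡0 = refl
∑-zero (suc n) f≡0 = cong₂ _+_ (f≡0 zero) (∑-zero n (f≡0 ∘ suc))

-- Each `there` moves one position from left to right, so the number `suc k` of unconstrained parts
-- stays fixed while `N` drops by one. Each possible position of the first zero thus contributes one
-- summand.
zeroedPair↔Fin : ∀ n m N k → n + m ≡ suc k →
                 ZeroedPair n (suc m) N ↔ Fin (∑[ j < n ] ((N + k ∸ toℕ j) C k))
zeroedPair↔Fin zero m N k eq = mk↔ₛ′ (λ ()) (λ ()) (λ ()) (λ ())
zeroedPair↔Fin (suc n) m N k refl = byValue N
  where
  compositions : ∀ N → WeakComposition (n + suc m) N ↔ Fin ((N + k) C k)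
  compositions N rewrite ℕ.+-suc n m = weakComposition↔Fin k N

  -- At value 0 only `here` is possible, so the later terms must vanish. An index `j : Fin n` forces
  -- `k` to be positive, which excludes `0 C 0 ≡ 1` arising from truncated subtraction.
  vanish : ∀ k (j : Fin n) → n ≤ k → (k ∸ suc (toℕ j)) C k ≡ 0
  vanish zero    j n≤k = contradiction (ℕ.<-≤-trans (Fin.toℕ<n j) n≤k) λ ()
  vanish (suc k) j n≤k = k>n⇒nCk≡0 (s≤s (ℕ.m∸n≤m k (toℕ j)))

  byValue : ∀ N → ZeroedPair (suc n) (suc m) N ↔ Fin (∑[ j < suc n ] ((N + k ∸ toℕ j) C k))
  byValue zero = Fin-cong
    (sym (trans (cong (k C k ℕ.+_) (∑-zero n (λ j → vanish k j (ℕ.m≤m+n n m)))) (ℕ.+-identityʳ _)))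
    (↔-trans zeroedPair-zero (compositions zero))
  -- Since `suc N + k ∸ suc j` computes to `N + k ∸ j`, the terms after the first are those for
  -- value `N`.
  byValue (suc N) = ↔-trans zeroedPair-suc
    (↔-+ (compositions (suc N)) (zeroedPair↔Fin n (suc m) N k (ℕ.+-suc n m)))

-- The additive structure of G-matrices

insert-at : ∀ i j (π : Permutation m n) → insert i j π ⟨$⟩ʳ i ≡ j
insert-at i j π with i Fin.≟ i
... | yes _   = refl
... | no  i≢i = contradiction refl i≢i

-- The permutation fixing 0 and sending suc i to suc j is compared with its
-- composition with the transposition of 0 and suc j.
exchange₀ : (B : Vector (Vector ℕ (suc n)) (suc n)) →
            (∀ (σ : Permutation′ (suc n)) → sum (λ r → B r (σ ⟨$⟩ʳ r)) ≡ N) →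
            ∀ i j → B i j + B zero zero ≡ B i zero + B zero j
exchange₀ B val zero    j       = ℕ.+-comm (B zero j) _
exchange₀ B val (suc i) zero    = refl
exchange₀ {suc n} {N} B val (suc i) (suc j) = ℕ.+-cancelʳ-≡ rest _ _ (begin
  B (suc i) (suc j) + B zero zero + rest    ≡⟨ rotate (B (suc i) (suc j)) (B zero zero) rest ⟩
  B zero zero + (B (suc i) (suc j) + rest)  ≡⟨ expand σ σ-at σ-off ⟨
  sum (λ r → B r (σ ⟨$⟩ʳ r))                ≡⟨ trans (val σ) (sym (val τ)) ⟩
  sum (λ r → B r (τ ⟨$⟩ʳ r))                ≡⟨ expand τ τ-at τ-off ⟩
  B zero (suc j) + (B (suc i) zero + rest)  ≡⟨ rotate (B (suc i) zero) (B zero (suc j)) rest ⟨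
  B (suc i) zero + B zero (suc j) + rest    ∎)
  where
  σ τ : Permutation′ (suc (suc n))
  σ = lift₀ (insert i j id)
  -- `punchIn (suc j)` sends `zero` to `zero` and `suc r` to `suc (punchIn j r)`, so `τ` maps
  -- `suc i` to `zero` and agrees with `σ` on the rows summed in `rest`.
  τ = insert zero (suc j) (insert i zero id)

  rest : ℕ
  rest = sum (λ r → B (suc (punchIn i r)) (suc (punchIn j r)))

  rotate : ∀ a b c → a + b + c ≡ b + (a + c)
  rotate = solve-∀

  expand : ∀ (π : Permutation′ (suc (suc n))) {l} → π ⟨$⟩ʳ suc i ≡ l →
           (∀ r → π ⟨$⟩ʳ suc (punchIn i r) ≡ suc (punchIn j r)) →
           sum (λ r → B r (π ⟨$⟩ʳ r)) ≡ B zero (π ⟨$⟩ʳ zero) + (B (suc i) l + rest)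
  expand π at off = cong (B zero (π ⟨$⟩ʳ zero) ℕ.+_)
    (trans (sum-remove {i = i} (λ r → B (suc r) (π ⟨$⟩ʳ suc r)))
      (cong₂ _+_ (cong (B (suc i)) at)
                 (sum-cong-≗ (λ r → cong (B (suc (punchIn i r))) (off r)))))

  σ-at : σ ⟨$⟩ʳ suc i ≡ suc j
  σ-at = cong suc (insert-at i j id)

  σ-off : ∀ r → σ ⟨$⟩ʳ suc (punchIn i r) ≡ suc (punchIn j r)
  σ-off r = cong suc (insert-punchIn i j id r)

  τ-at : τ ⟨$⟩ʳ suc i ≡ zero
  τ-at = cong (punchIn (suc j)) (insert-at i zero id)

  τ-off : ∀ r → τ ⟨$⟩ʳ suc (punchIn i r) ≡ suc (punchIn j r)
  τ-off r = cong (punchIn (suc j)) (insert-punchIn i zero id r)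

argmin : (f : Vector ℕ (suc n)) → ∃[ i ] (∀ j → f i ≤ f j)
argmin {zero}  f = zero , λ { zero → ℕ.≤-refl }
argmin {suc n} f with i , min ← argmin (tail f) with ℕ.≤-total (f zero) (f (suc i))
... | inj₁ f₀≤fᵢ = zero , λ { zero → ℕ.≤-refl ; (suc j) → ℕ.≤-trans f₀≤fᵢ (min j) }
... | inj₂ fᵢ≤f₀ = suc i , λ { zero → fᵢ≤f₀ ; (suc j) → min j }

-- Let row `p` attain the minimum of column 0. Then `x` is column 0 lowered by that minimum, so the
-- truncated subtraction is exact and `x p` is 0; row `p` serves as `y`.
additive-decomposition : (B : Vector (Vector ℕ (suc n)) (suc n)) →
  (∀ i j → B i j + B zero zero ≡ B i zero + B zero j) →
  Σ[ x ∈ Vector ℕ (suc n) ] Σ[ y ∈ Vector ℕ (suc n) ]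
    (∃[ i ] x i ≡ 0) × (∀ i j → B i j ≡ x i + y j)
additive-decomposition {n} B exch with p , min ← argmin (λ i → B i zero) =
  (λ i → B i zero ∸ B p zero) , B p , (p , ℕ.n∸n≡0 (B p zero)) ,
  λ i j → ℕ.+-cancelʳ-≡ (B p zero) _ _ (begin
    B i j + B p zero                            ≡⟨ exchange i j ⟩
    B i zero + B p j                            ≡⟨ cong (_+ B p j) (ℕ.m∸n+n≡m (min i)) ⟨
    B i zero ∸ B p zero + B p zero + B p j      ≡⟨ swapʳ (B i zero ∸ B p zero) _ _ ⟩
    B i zero ∸ B p zero + B p j + B p zero      ∎)
  where
  swapʳ : ∀ a b c → a + b + c ≡ a + c + b
  swapʳ = solve-∀

  regroup : ∀ a b c → a + b + c ≡ a + (c + b)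
  regroup = solve-∀

  -- Row `p` replaces row 0 as the reference row, by applying `exch` at both `i` and `p`.
  exchange : ∀ i j → B i j + B p zero ≡ B i zero + B p j
  exchange i j = ℕ.+-cancelʳ-≡ (B zero zero) _ _ (begin
    B i j + B p zero + B zero zero     ≡⟨ swapʳ (B i j) _ _ ⟩
    B i j + B zero zero + B p zero     ≡⟨ cong (_+ B p zero) (exch i j) ⟩
    B i zero + B zero j + B p zero     ≡⟨ regroup (B i zero) _ _ ⟩
    B i zero + (B p zero + B zero j)   ≡⟨ cong (B i zero ℕ.+_) (exch p j) ⟨
    B i zero + (B p j + B zero zero)   ≡⟨ ℕ.+-assoc (B i zero) _ _ ⟨
    B i zero + B p j + B zero zero     ∎)

-- With x i = 0 and x′ i′ = 0, y j = x′ i + y′ j and y′ j = x i′ + y j, so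
-- that x′ i = 0.
additive-unique : {x x′ : Vector ℕ n} {y y′ : Vector ℕ m} →
  (∃[ i ] x i ≡ 0) → (∃[ i ] x′ i ≡ 0) → Fin m →
  (∀ i j → x i + y j ≡ x′ i + y′ j) → x ≗ x′ × y ≗ y′
additive-unique {x = x} {x′} {y} {y′} (p , xₚ≡0) (q , x′q≡0) j₀ eq =
  (λ i → ℕ.+-cancelʳ-≡ (y j₀) _ _ (trans (eq i j₀) (cong (x′ i ℕ.+_) (sym (y≗y′ j₀))))) , y≗y′
  where
  y′≤y : ∀ j → y′ j ≤ y j
  y′≤y j = subst (y′ j ≤_) (trans (sym (eq p j)) (cong (_+ y j) xₚ≡0)) (ℕ.m≤n+m (y′ j) (x′ p))

  y≤y′ : ∀ j → y j ≤ y′ j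
  y≤y′ j = subst (y j ≤_) (trans (eq q j) (cong (_+ y′ j) x′q≡0)) (ℕ.m≤n+m (y j) (x q))

  y≗y′ : y ≗ y′
  y≗y′ j = ℕ.≤-antisym (y≤y′ j) (y′≤y j)

-- A permutation only reorders the entries of the right vector, so all permutations give the same
-- sum.
pairMatrix : ZeroedPair n n N → ∃ (IsGMatrix {n} N)
pairMatrix {n} {N} z = (λ i j → + (left z i + right z j)) , record
  { nonNegative = λ i j → +≤+ z≤n
  ; value       = λ σ → trans (∑-pos (λ i → left z i + right z (σ ⟨$⟩ʳ i))) (cong +_ (begin
      ∑[ i < n ] (left z i + right z (σ ⟨$⟩ʳ i))
        ≡⟨ ∑-distrib-+ (left z) (λ i → right z (σ ⟨$⟩ʳ i)) ⟩
      sum (left z) + ∑[ i < n ] (right z (σ ⟨$⟩ʳ i))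
        ≡⟨ cong (sum (left z) ℕ.+_) (sum-permute (right z) σ) ⟨
      sum (left z) + sum (right z)
        ≡⟨ ∑-left-right z ⟩
      N ∎))
  }

pairMatrix-injective : {z z′ : ZeroedPair (suc n) (suc n) N} →
  (∀ i j → proj₁ (pairMatrix z) i j ≡ proj₁ (pairMatrix z′) i j) → z ≡ z′
pairMatrix-injective {z = z} {z′} eq
  with l , r ← additive-unique (left-zero z) (left-zero z′) zero (λ i j → ℤ.+-injective (eq i j))
  = left-right-injective l r

module _ {n N} {A : Matrix (suc n)} (isG : IsGMatrix N A) where
  open IsGMatrix isG

  private
    -- By nonnegativity, absolute values carry the matrix to ℕ without loss.
    B : Vector (Vector ℕ (suc n)) (suc n)
    B i j = ∣ A i j ∣

    +B≡A : ∀ i j → + B i j ≡ A i j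
    +B≡A i j = ℤ.0≤i⇒+∣i∣≡i (nonNegative i j)

    ∑B : ∀ (σ : Permutation′ (suc n)) → sum (λ i → B i (σ ⟨$⟩ʳ i)) ≡ N
    ∑B σ = ℤ.+-injective (trans (sym (∑-pos (λ i → B i (σ ⟨$⟩ʳ i))))
      (trans (ℤSum.sum-cong-≗ (λ i → +B≡A i (σ ⟨$⟩ʳ i))) (value σ)))

  pairMatrix-surjective : ∃[ z ] (∀ i j → proj₁ (pairMatrix {suc n} {N} z) i j ≡ A i j)
  pairMatrix-surjective
    with x , y , (i , xᵢ≡0) , B≡x+y ← additive-decomposition B (exchange₀ B ∑B)
    with z , l , r ← left-right-surjective (suc n) N x y i xᵢ≡0
           -- The value at the identity permutation is the total of `x` and `y`.
           (trans (sym (∑-distrib-+ x y))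
             (trans (sum-cong-≗ {x = λ i → x i + y i} {λ i → B i i} (λ i → sym (B≡x+y i i))) (∑B id)))
    = z , λ i j → trans (cong +_ (trans (cong₂ _+_ (l i) (r j)) (sym (B≡x+y i j)))) (+B≡A i j)

-- The cardinality and its closed form

module _ (S : Setoid a ℓ) where
  private
    module S = Setoid S

  -- Surjectivity chooses a preimage, and injectivity makes the choice respect the equality of `S`.
  bijection⇒inverse : {B : Set b} (f : B → S.Carrier) →
                      (∀ {x y} → f x S.≈ f y → x ≡ y) → (∀ s → ∃[ x ] f x S.≈ s) →
                      Inverse S (setoid B)
  bijection⇒inverse f inj surj = record
    { to        = λ s → proj₁ (surj s)
    ; from      = f
    ; to-cong   = λ {s} {t} s≈t →
        inj (S.trans (proj₂ (surj s)) (S.trans s≈t (S.sym (proj₂ (surj t)))))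
    ; from-cong = λ { refl → S.refl }
    ; inverse   = (λ {x} {s} s≈fx → inj (S.trans (proj₂ (surj s)) s≈fx))
                , (λ { {s} refl → proj₂ (surj s) })
    }

gMatrices-cardinality : ∀ n N →
  HasCardinality (GMatrices (suc n) N) (∑[ j < suc n ] ((N + (n + n) ∸ toℕ j) C (n + n)))
gMatrices-cardinality n N = inverse
  (bijection⇒inverse (GMatrices (suc n) N) pairMatrix pairMatrix-injective
    λ (_ , isG) → pairMatrix-surjective isG)
  -- With d = `suc n`, the 2d - 1 unconstrained parts make `k` equal to 2d - 2, that is `n + n`.
  (zeroedPair↔Fin (suc n) n N (n + n) refl)

-- Pascal's rule absorbs the terms one by one. The subtracted binomial stands on the left to stay
-- within ℕ, and the bound on `e` keeps every `∸` exact.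
∑-C-telescope : ∀ e M k → e ≤ suc M →
                ∑[ j < e ] ((M ∸ toℕ j) C k) + (suc M ∸ e) C suc k ≡ suc M C suc k
∑-C-telescope zero          M       k e≤    = refl
∑-C-telescope (suc zero)    zero    k e≤    =
  trans (cong (_+ 0 C suc k) (ℕ.+-identityʳ (0 C k))) (nCk+nC[k+1]≡[n+1]C[k+1] 0 k)
∑-C-telescope (suc (suc e)) zero    k (s≤s ())
∑-C-telescope (suc e)       (suc M) k (s≤s e≤) =
  trans (ℕ.+-assoc (suc M C k) _ _)
    (trans (cong (suc M C k ℕ.+_) (∑-C-telescope e M k e≤)) (nCk+nC[k+1]≡[n+1]C[k+1] (suc M) k))

i+k≡j⇒+i≡+j-+k : ∀ {i j k} → i + k ≡ j → + i ≡ + j - + k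
i+k≡j⇒+i≡+j-+k {i} {k = k} refl = sym (begin
  + (i + k) - + k  ≡⟨ ℤ.[+m]-[+n]≡m⊖n (i + k) k ⟩
  (i + k) ⊖ k      ≡⟨ ℤ.⊖-≥ (ℕ.m≤n+m k i) ⟩
  + (i + k ∸ k)    ≡⟨ cong +_ (ℕ.m+n∸n≡m i k) ⟩
  + i              ∎)

∑-C-closed : ∀ n N → let k = n + n in
  ∑[ j < suc n ] ((N + k ∸ toℕ j) C k) + (N + n) C suc k ≡ suc (N + k) C suc k
∑-C-closed n N = trans
  (cong (λ c → ∑[ j < suc n ] ((N + (n + n) ∸ toℕ j) C (n + n)) + c C suc (n + n)) N+n≡N+2n∸n)
  (∑-C-telescope (suc n) (N + (n + n)) (n + n) (s≤s (ℕ.m≤n⇒m≤o+n N (ℕ.m≤m+n n n))))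
  where
  -- The telescope leaves `suc M ∸ suc n` with `M` equal to `N + (n + n)`, which computes to this
  -- right-hand side.
  N+n≡N+2n∸n : N + n ≡ N + (n + n) ∸ n
  N+n≡N+2n∸n = sym (trans (cong (_∸ n) (sym (ℕ.+-assoc N n n))) (ℕ.m+n∸n≡m (N + n) n))

2*[1+n]≡2+n+n : ∀ n → 2 * suc n ≡ suc (suc (n + n))
2*[1+n]≡2+n+n = solve-∀

mainTheorem5 : ∀ (d : ℕ) → 1 ≤ d → ∀ (N : ℕ) →
    ∃[ g ] (HasCardinality (GMatrices d N) g
    × g ≡ ∑[ j < d ] ((N + 2 * d ∸ 2 ∸ toℕ j) C (2 * d ∸ 2))
    × + g ≡ + ((N + 2 * d ∸ 1) C (2 * d ∸ 1)) - + ((N + d ∸ 1) C (2 * d ∸ 1)))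
mainTheorem5 (suc n) _ N = withDouble (2 * suc n) (2*[1+n]≡2+n+n n)
  where
  -- 2 * suc n is generalised to a variable since it unfolds to a term in
  -- which it no longer occurs.
  withDouble : ∀ e → e ≡ suc (suc (n + n)) →
    ∃[ g ] (HasCardinality (GMatrices (suc n) N) g
    × g ≡ ∑[ j < suc n ] ((N + e ∸ 2 ∸ toℕ j) C (e ∸ 2))
    × + g ≡ + ((N + e ∸ 1) C (e ∸ 1)) - + ((N + suc n ∸ 1) C (e ∸ 1)))
  -- Moving the successors outward lets the subtractions of 1 and 2 compute.
  withDouble _ refl rewrite ℕ.+-suc N (suc (n + n)) | ℕ.+-suc N (n + n) | ℕ.+-suc N n
    = _ , gMatrices-cardinality n N , refl , i+k≡j⇒+i≡+j-+k (∑-C-closed n N)
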